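{- Let $G$ be a graph, let $k$ and $t$ be integers with $1\le t\le k$, and let $S_1$ and $S_2$ be two disjoint subsets of $V(G)$ such that $S_1$ and $S_2$ are $k$-linked. If each $S_i$ has a subset $T_i$ of size $k-t$, for $i\in\{1,2\}$, such that $T_1$ and $T_2$ are $(k-t)$-linked, then there is a subset $T_i'\subseteq S_i\setminus T_i$ of size $t$ for each $i\in\{1,2\}$ such that $T_1\cup T_1'$ and $T_2\cup T_2'$ are $k$-linked.
   Context: Graphs are finite and simple. For an integer $m\ge 0$, two disjoint vertex subsets $A_1$ and $A_2$ of a graph $G$ are $m$-linked (in $G$) if there exist $m$ pairwise vertex-disjoint paths in $G$ joining $m$ distinct vertices of $A_1$ to $m$ distinct vertices of $A_2$ such that each of the $m$ paths meets $A_i$ in exactly one vertex for each $i\in\{1,2\}$. -}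

module Defs where

open import Data.Nat.Base using (ℕ)
open import Data.Fin.Base using (Fin)
open import Data.Fin.Subset using (Subset) renaming (_∈_ to _∈ₛ_)
open import Data.List.Base using (List; []; _∷_)
open import Data.List.Membership.Propositional using (_∈_)
open import Data.List.Relation.Binary.Disjoint.Propositional using (Disjoint)
open import Data.List.Relation.Unary.Unique.Propositional using (Unique)
open import Data.Product using (∃!; _×_)
open import Function.Definitions using (Injective)
open import Level using (0ℓ)
open import Relation.Binary.Core using (Rel)
open import Relation.Binary.Construct.Closure.ReflexiveTransitive using (Star; ε; _◅_)
open import Relation.Binary.Definitions using (Decidable; Irreflexive; Symmetric)
open import Relation.Binary.PropositionalEquality.Core using (_≡_; _≢_)

-- A finite simple graph, its vertices numbered by Fin n. The edge set is a
-- finite set, hence adjacency is decidable.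
record Graph (n : ℕ) : Set₁ where
  field
    Adj    : Rel (Fin n) 0ℓ
    adj?   : Decidable Adj
    sym    : Symmetric Adj
    irrefl : Irreflexive _≡_ Adj

module _ {n : ℕ} (G : Graph n) where

  open Graph G

  Walk : Fin n → Fin n → Set
  Walk = Star Adj

  vertices : ∀ {u v} → Walk u v → List (Fin n)
  vertices {u} ε       = u ∷ []
  vertices {u} (_ ◅ w) = u ∷ vertices w

  record Path (u v : Fin n) : Set where
    constructor mkPath
    field
      walk   : Walk u v
      unique : Unique (vertices walk)

    support : List (Fin n)
    support = vertices walk

  open Path

  MeetsOnce : ∀ {u v} → Path u v → Subset n → Set
  MeetsOnce p A = ∃! _≡_ λ x → x ∈ support p × x ∈ₛ A

  -- The notion is meant for disjoint A₁ and A₂;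
  -- disjointness is left to be assumed where the notion is used.
  record Linked (m : ℕ) (A₁ A₂ : Subset n) : Set where
    field
      start end       : Fin m → Fin n
      start-injective : Injective _≡_ _≡_ start
      end-injective   : Injective _≡_ _≡_ end
      start∈A₁        : ∀ i → start i ∈ₛ A₁
      end∈A₂          : ∀ i → end i ∈ₛ A₂
      path            : ∀ i → Path (start i) (end i)
      disjoint        : ∀ {i j} → i ≢ j → Disjoint (support (path i)) (support (path j))
      meets-A₁        : ∀ i → MeetsOnce (path i) A₁
      meets-A₂        : ∀ i → MeetsOnce (path i) A₂

{-# OPTIONS --safe #-}
module Submission where

-- Pym's linkage theorem, by way of kernels. Given disjoint path systems P and Q, order the vertices
-- common to both by "earlier on a path of P" and by "later on a path of Q". Two partial orders on a
-- finite set have a common kernel (Sands, Sauer and Woodrow): a set that is independent in both and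
-- that absorbs every other element in one of them. Let each path of P change over to Q at its kernel
-- vertex, if it has one. Absorption makes the new paths disjoint, and each path of P has a new path
-- starting where it does. If P has at most as many paths as Q, then unswitched paths of P can
-- replace untouched paths of Q so that exactly as many paths as in Q remain.
-- Applied to the T-linkage and the S-linkage this covers T₁. Applied again to the reversed systems it
-- covers T₂ as well, and it leaves the starts alone: every path of P then meets Q at its very end,
-- so it has a kernel vertex.

open import Defs
open import Data.Fin.Base using (Fin; zero; suc; punchIn)
open import Data.Fin.Induction using (spo-wellFounded)
open import Data.Fin.Properties as Fin
  using (_≟_; any?; all?; ¬∀⟶∃¬; suc-injective; injective⇒≤; punchIn-injective; punchInᵢ≢i; punchIn-punchOut)
open import Data.Fin.Subset using (Subset; Empty; _⊆_; _⊂_; _∩_; _∪_; _─_; _-_; ∣_∣; ⊥; ⁅_⁆; inside; outside)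
  renaming (_∈_ to _∈ₛ_; _∉_ to _∉ₛ_)
open import Data.Fin.Subset.Induction using (⊂-wellFounded)
open import Data.Fin.Subset.Properties as Subset
  using (_∈?_; p─q⊆p; x∈p⇒p-x⊂p; x∈p∧x≢y⇒x∈p-y; x∈p∪q⁻; x∈p∪q⁺; x∈p∩q⁻;
         x∈⁅x⁆; x∈⁅y⁆⇒x≡y; ∣⊥∣≡0; ∣⁅x⁆∣≡1; ∉⊥; p⊂q⇒∣p∣<∣q∣; x∈p∧x∉q⇒x∈p─q; ⊆-antisym)
open import Data.List.Base using (List; []; _∷_; _++_; [_]; reverse)
open import Data.List.Membership.Propositional using (_∈_)
open import Data.List.Membership.Propositional.Properties using (∈-++⁻)
open import Data.List.Properties using (unfold-reverse)
open import Data.List.Relation.Binary.Disjoint.Propositional using (Disjoint)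
open import Data.List.Relation.Binary.Permutation.Propositional using (_↭_; ↭-sym; ↭⇒↭ₛ)
open import Data.List.Relation.Binary.Permutation.Propositional.Properties using (↭-reverse; ∈-resp-↭)
import Data.List.Relation.Binary.Permutation.Setoid.Properties as Permutation
import Data.List.Relation.Binary.Sublist.DecPropositional as DecSublist
import Data.List.Relation.Binary.Sublist.Propositional as Sublist
open Sublist using ([]; _∷_; _∷ʳ_)
import Data.List.Relation.Binary.Sublist.Propositional.Properties as Sublistₚ
open import Data.List.Relation.Unary.All using (lookup)
open import Data.List.Relation.Unary.AllPairs using ([]; _∷_)
open import Data.List.Relation.Unary.Any as Any using (here; there)
open import Data.List.Relation.Unary.Unique.Propositional using (Unique)
import Data.List.Relation.Unary.Unique.Propositional.Properties as Unique
open import Data.Nat.Base using (ℕ; zero; suc; _+_; _≤_; _∸_; s≤s)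
open import Data.Nat.Properties using (<⇒≱; <-irrefl; +-cancelˡ-≡; +-suc; m∸n+n≡m; m∸n≤m)
open import Data.Product.Base using (∃₂; ∃-syntax; _×_; _,_; proj₁; proj₂)
open import Data.Sum.Base using (_⊎_; inj₁; inj₂)
open import Data.Vec.Base using (tabulate; _∷_; []; here; there)
open import Data.Vec.Properties using ([]=⇒lookup; lookup⇒[]=; lookup∘tabulate)
open import Function.Base using (_∘_; flip)
open import Function.Definitions using (Injective)
open import Induction.WellFounded using (Acc; acc)
open import Level using (0ℓ)
open import Relation.Binary.Construct.Closure.ReflexiveTransitive using (ε; _◅_; _◅◅_)
open import Relation.Binary.Core using (Rel; REL)
import Relation.Binary.Construct.Flip.EqAndOrd as Flip
import Relation.Binary.Definitions as B
open import Relation.Binary.Structures using (IsStrictPartialOrder)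
open import Relation.Binary.PropositionalEquality.Core using (_≡_; _≢_; refl; sym; trans; cong; cong₂; subst; subst₂)
open import Relation.Binary.PropositionalEquality.Properties using (isEquivalence; setoid; module ≡-Reasoning)
open import Relation.Nullary using (¬_; Dec; yes; no; does; contradiction)
open import Relation.Nullary.Decidable using (_×-dec_; ¬?; dec-true)
open import Relation.Unary using (Pred; Decidable)

private
  variable
    n m k : ℕ

-- Subsets cut out by decidable predicates

module _ {P : Pred (Fin n) 0ℓ} (P? : Decidable P) where

  abstract
    comprehension : Subset n
    comprehension = tabulate (does ∘ P?)

    ∈-comprehension⁺ : ∀ {x} → P x → x ∈ₛ comprehension
    ∈-comprehension⁺ {x} px = lookup⇒[]= x _ (trans (lookup∘tabulate _ x) (dec-true (P? x) px))

    ∈-comprehension⁻ : ∀ {x} → x ∈ₛ comprehension → P x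
    ∈-comprehension⁻ {x} x∈ with P? x | trans (sym (lookup∘tabulate (does ∘ P?) x)) ([]=⇒lookup x∈)
    ... | yes px | _  = px
    ... | no _   | ()

-- Common kernels of two strict partial orders

module _ {_<₁_ _<₂_ : Rel (Fin n) 0ℓ} where

  -- Relative to a set `U`, because the construction deletes elements one at a time.
  record Kernel (U : Subset n) : Set where
    field
      set          : Subset n
      set⊆         : set ⊆ U
      independent₁ : ∀ {x y} → x ∈ₛ set → y ∈ₛ set → ¬ x <₁ y
      independent₂ : ∀ {x y} → x ∈ₛ set → y ∈ₛ set → ¬ x <₂ y
      absorbing    : ∀ {x} → x ∈ₛ U → x ∈ₛ set ⊎ ∃[ y ] y ∈ₛ set × (y <₁ x ⊎ y <₂ x)

  module _ (_<₁?_ : B.Decidable _<₁_) (_<₂?_ : B.Decidable _<₂_)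
           (<₁-isSPO : IsStrictPartialOrder _≡_ _<₁_)
           (<₂-isSPO : IsStrictPartialOrder _≡_ _<₂_) where

    private
      Minimal : Subset n → Pred (Fin n) 0ℓ
      Minimal U x = x ∈ₛ U × ¬ (∃[ y ] y ∈ₛ U × y <₁ x)

      minimal? : ∀ U → Decidable (Minimal U)
      minimal? U x = (x ∈? U) ×-dec ¬? (any? λ y → (y ∈? U) ×-dec (y <₁? x))

      module <₁ = IsStrictPartialOrder <₁-isSPO
      module <₂ = IsStrictPartialOrder <₂-isSPO

      -- Descend along `_<₁_` inside `U`; the descent stops by well-foundedness, and transitivity
      -- keeps its last element below `x`.
      minimal-below : ∀ {U x} → Acc _<₁_ x → x ∈ₛ U →
                      Minimal U x ⊎ ∃[ y ] Minimal U y × y <₁ x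
      minimal-below {U} {x} (acc rs) x∈U with any? (λ y → (y ∈? U) ×-dec (y <₁? x))
      ... | no ¬below = inj₁ (x∈U , ¬below)
      ... | yes (y , y∈U , y<x) with minimal-below (rs y<x) y∈U
      ...   | inj₁ y-min               = inj₂ (y , y-min , y<x)
      ...   | inj₂ (z , z-min , z<y)   = inj₂ (z , z-min , <₁.trans z<y y<x)

      -- If a <₁-minimal a has a <₂ b, a kernel of U - b is one of U: it contains a, or else some
      -- y <₂ a, hence y <₂ b. Without such a pair the <₁-minimal elements form a kernel.
      kernel-acc : ∀ {U} → Acc _⊂_ U → Kernel U
      kernel-acc {U} (acc rs)
        with any? (λ b → (b ∈? U) ×-dec any? (λ a → minimal? U a ×-dec (a <₂? b)))
      ... | no independent = record
        { set          = comprehension (minimal? U)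
        ; set⊆         = λ x∈ → proj₁ (∈-comprehension⁻ (minimal? U) x∈)
        ; independent₁ = λ x∈ y∈ x<y →
            proj₂ (∈-comprehension⁻ (minimal? U) y∈) (_ , proj₁ (∈-comprehension⁻ (minimal? U) x∈) , x<y)
        ; independent₂ = λ x∈ y∈ x<y →
            independent (_ , proj₁ (∈-comprehension⁻ (minimal? U) y∈) , _ , ∈-comprehension⁻ (minimal? U) x∈ , x<y)
        ; absorbing    = absorb
        }
        where
        absorb : ∀ {x} → x ∈ₛ U → x ∈ₛ comprehension (minimal? U) ⊎
                 ∃[ y ] y ∈ₛ comprehension (minimal? U) × (y <₁ x ⊎ y <₂ x)
        absorb x∈U with minimal-below (spo-wellFounded <₁-isSPO _) x∈U
        ... | inj₁ x-min             = inj₁ (∈-comprehension⁺ (minimal? U) x-min)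
        ... | inj₂ (y , y-min , y<x) = inj₂ (y , ∈-comprehension⁺ (minimal? U) y-min , inj₁ y<x)
      ... | yes (b , b∈U , a , (a∈U , a-min) , a<b) = record
        { set          = set
        ; set⊆         = p─q⊆p U ⁅ b ⁆ ∘ set⊆
        ; independent₁ = independent₁
        ; independent₂ = independent₂
        ; absorbing    = absorb
        }
        where
        open Kernel (kernel-acc (rs (x∈p⇒p-x⊂p b∈U)))
        absorb : ∀ {x} → x ∈ₛ U → x ∈ₛ set ⊎ ∃[ y ] y ∈ₛ set × (y <₁ x ⊎ y <₂ x)
        absorb {x} x∈U with x ≟ b
        ... | no x≢b = absorbing (x∈p∧x≢y⇒x∈p-y x∈U x≢b)
        ... | yes refl with a ≟ b
        ...   | yes refl = contradiction a<b (<₂.irrefl refl)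
        ...   | no a≢b with absorbing (x∈p∧x≢y⇒x∈p-y a∈U a≢b)
        ...     | inj₁ a∈set                  = inj₂ (a , a∈set , inj₂ a<b)
        ...     | inj₂ (y , y∈set , inj₁ y<a) =
                  contradiction (y , p─q⊆p U ⁅ b ⁆ (set⊆ y∈set) , y<a) a-min
        ...     | inj₂ (y , y∈set , inj₂ y<a) = inj₂ (y , y∈set , inj₂ (<₂.trans y<a a<b))

    abstract
      kernel : ∀ U → Kernel U
      kernel U = kernel-acc (⊂-wellFounded U)

-- Extending a partial matching to an injection

abstract
  -- Match the rows one at a time: since m ≤ k, a row without a partner can take a column that is
  -- the partner of no later row.
  extendMatching : ∀ {m k} {_~_ : REL (Fin m) (Fin k) 0ℓ} → B.Decidable _~_ → m ≤ k →
                   (∀ {p q q′} → p ~ q → p ~ q′ → q ≡ q′) →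
                   (∀ {p p′ q} → p ~ q → p′ ~ q → p ≡ p′) →
                   ∃[ f ] Injective _≡_ _≡_ f × (∀ {p q} → p ~ q → f p ≡ q)
  extendMatching {zero} _ _ _ _ = (λ ()) , (λ { {()} }) , λ { {()} }
  extendMatching {suc m} {suc k} {_~_} _~?_ (s≤s m≤k) functional injective = f , f-injective , f-extends
    where
    -- The column for row `zero`: the forced one if there is one, and in any case a column that no
    -- later row claims, so that the other rows can be matched with it removed.
    partner : ∃[ q ] (∀ {q′} → zero ~ q′ → q ≡ q′) × (∀ {p} → ¬ suc p ~ q)
    partner with any? (zero ~?_)
    ... | yes (q , z~q) = q , functional z~q , λ p~q → Fin.0≢1+n (injective z~q p~q)
    ... | no alone with all? (λ q → any? (λ p → suc p ~? q))
    -- Pigeonhole: if later rows claimed all `suc k` columns, choosing a claimant for each would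
    -- inject the columns into `m` rows.
    ...   | yes full = contradiction (injective⇒≤ back-injective) (<⇒≱ (s≤s m≤k))
      where
      back : Fin (suc k) → Fin m
      back q = proj₁ (full q)
      back-injective : Injective _≡_ _≡_ back
      back-injective {q} {q′} eq =
        functional (proj₂ (full q)) (subst (λ p → suc p ~ q′) (sym eq) (proj₂ (full q′)))
    ...   | no ¬full with ¬∀⟶∃¬ _ _ (λ q → any? (λ p → suc p ~? q)) ¬full
    ...     | q , free = q , (λ z~q′ → contradiction (_ , z~q′) alone) , λ p~q → free (_ , p~q)

    q₀ : Fin (suc k)
    q₀ = proj₁ partner

    rest : ∃[ g ] Injective _≡_ _≡_ g × (∀ {p q} → suc p ~ punchIn q₀ q → g p ≡ q)
    rest = extendMatching (λ p q → suc p ~? punchIn q₀ q) m≤k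
      (λ a b → punchIn-injective q₀ _ _ (functional a b))
      (λ a b → suc-injective (injective a b))

    f : Fin (suc m) → Fin (suc k)
    f zero    = q₀
    f (suc p) = punchIn q₀ (proj₁ rest p)

    f-injective : Injective _≡_ _≡_ f
    f-injective {zero}  {zero}   _  = refl
    f-injective {zero}  {suc p′} eq = contradiction (sym eq) (punchInᵢ≢i q₀ _)
    f-injective {suc p} {zero}   eq = contradiction eq (punchInᵢ≢i q₀ _)
    f-injective {suc p} {suc p′} eq = cong suc (proj₁ (proj₂ rest) (punchIn-injective q₀ _ _ eq))

    f-extends : ∀ {p q} → p ~ q → f p ≡ q
    f-extends {zero}      p~q = proj₁ (proj₂ partner) p~q
    f-extends {suc p} {q} p~q with q₀ ≟ q
    ... | yes refl = contradiction p~q (proj₂ (proj₂ partner))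
    ... | no q₀≢q = trans (cong (punchIn q₀) (proj₂ (proj₂ rest) (subst (suc p ~_) (sym (punchIn-punchOut q₀≢q)) p~q)))
                          (punchIn-punchOut q₀≢q)

-- Order of occurrence in a list

module _ {A : Set} where

  -- Encoded as a sublist, so that decidability and passage to longer lists are those of sublists.
  -- It is a strict order once `xs` has no repetitions.
  Before : A → A → List A → Set
  Before x y xs = (x ∷ y ∷ []) Sublist.⊆ xs

  private
    variable
      x y z : A
      xs ys : List A

  Before⇒∈ˡ : Before x y xs → x ∈ xs
  Before⇒∈ˡ xy = Sublist.lookup xy (here refl)

  Before⇒∈ʳ : Before x y xs → y ∈ xs
  Before⇒∈ʳ xy = Sublist.lookup xy (there (here refl))

  ++-Before : x ∈ xs → y ∈ ys → Before x y (xs ++ ys)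
  ++-Before x∈xs y∈ys = Sublistₚ.++⁺ (Sublist.from∈ x∈xs) (Sublist.from∈ y∈ys)

  -- Uniqueness identifies the two occurrences of `y`. In the list y, z, x, y the conclusion would
  -- fail.
  Before-trans : Unique xs → Before x y xs → Before y z xs → Before x z xs
  Before-trans (_ ∷ u)  (_ ∷ʳ xy)   (_ ∷ʳ yz)   = _ ∷ʳ Before-trans u xy yz
  Before-trans (a ∷ _)  (_ ∷ʳ xy)   (refl ∷ _)  = contradiction refl (lookup a (Before⇒∈ʳ xy))
  Before-trans _        (refl ∷ _)  (_ ∷ʳ yz)   = refl ∷ Sublist.from∈ (Before⇒∈ʳ yz)
  Before-trans (a ∷ _)  (refl ∷ y∈) (refl ∷ _)  = contradiction refl (lookup a (Sublist.to∈ y∈))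

  Before-irrefl : Unique xs → ¬ Before x x xs
  Before-irrefl (_ ∷ u) (_ ∷ʳ xx)   = Before-irrefl u xx
  Before-irrefl (a ∷ _) (refl ∷ x∈) = lookup a (Sublist.to∈ x∈) refl

  Before-asym : Unique xs → Before x y xs → ¬ Before y x xs
  Before-asym u xy yx = Before-irrefl u (Before-trans u xy yx)

  Before-total : x ∈ xs → y ∈ xs → x ≡ y ⊎ Before x y xs ⊎ Before y x xs
  Before-total (here refl) (here refl) = inj₁ refl
  Before-total (here refl) (there y∈)  = inj₂ (inj₁ (refl ∷ Sublist.from∈ y∈))
  Before-total (there x∈)  (here refl) = inj₂ (inj₂ (refl ∷ Sublist.from∈ x∈))
  Before-total (there x∈)  (there y∈) with Before-total x∈ y∈
  ... | inj₁ eq        = inj₁ eq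
  ... | inj₂ (inj₁ xy) = inj₂ (inj₁ (_ ∷ʳ xy))
  ... | inj₂ (inj₂ yx) = inj₂ (inj₂ (_ ∷ʳ yx))

  Unique-resp-⊇ : xs Sublist.⊆ ys → Unique ys → Unique xs
  Unique-resp-⊇ []         _       = []
  Unique-resp-⊇ (_ ∷ʳ s)   (_ ∷ u) = Unique-resp-⊇ s u
  Unique-resp-⊇ (refl ∷ s) (a ∷ u) = Sublistₚ.All-resp-⊆ s a ∷ Unique-resp-⊇ s u

-- Cutting, gluing and reversing walks

module _ (G : Graph n) where

  open Path
  private
    module G = Graph G
    variable
      u v w x y : Fin n

  -- Omits the first vertex, so that gluing two walks lists their common vertex only once.
  tailVertices : Walk G u v → List (Fin n)
  tailVertices ε       = []
  tailVertices (_ ◅ w) = vertices G w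

  vertices≡∷ : (w : Walk G u v) → vertices G w ≡ u ∷ tailVertices w
  vertices≡∷ ε       = refl
  vertices≡∷ (_ ◅ _) = refl

  start∈vertices : (w : Walk G u v) → u ∈ vertices G w
  start∈vertices ε       = here refl
  start∈vertices (_ ◅ _) = here refl

  end∈vertices : (w : Walk G u v) → v ∈ vertices G w
  end∈vertices ε       = here refl
  end∈vertices (_ ◅ w) = there (end∈vertices w)

  ≡end⊎Before-end : (w : Walk G u v) → x ∈ vertices G w → x ≡ v ⊎ Before x v (vertices G w)
  ≡end⊎Before-end ε       (here refl) = inj₁ refl
  ≡end⊎Before-end (_ ◅ w) (here refl) = inj₂ (refl ∷ Sublist.from∈ (end∈vertices w))
  ≡end⊎Before-end (_ ◅ w) (there x∈) with ≡end⊎Before-end w x∈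
  ... | inj₁ eq = inj₁ eq
  ... | inj₂ xv = inj₂ (_ ∷ʳ xv)

  vertices-◅◅ : (w₁ : Walk G u v) (w₂ : Walk G v w) →
                vertices G (w₁ ◅◅ w₂) ≡ vertices G w₁ ++ tailVertices w₂
  vertices-◅◅ ε        w₂ = vertices≡∷ w₂
  vertices-◅◅ (e ◅ w₁) w₂ = cong (_ ∷_) (vertices-◅◅ w₁ w₂)

  split : (w : Walk G u v) → x ∈ vertices G w →
          ∃₂ λ (w₁ : Walk G u x) (w₂ : Walk G x v) → vertices G w ≡ vertices G w₁ ++ tailVertices w₂
  split ε       (here refl) = ε , ε , refl
  split (e ◅ w) (here refl) = ε , e ◅ w , refl
  split (e ◅ w) (there x∈) with split w x∈
  ... | w₁ , w₂ , eq = e ◅ w₁ , w₂ , cong (_ ∷_) eq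

  reverseWalk : Walk G u v → Walk G v u
  reverseWalk ε       = ε
  reverseWalk (e ◅ w) = reverseWalk w ◅◅ (G.sym e ◅ ε)

  vertices-reverseWalk : (w : Walk G u v) → vertices G (reverseWalk w) ≡ reverse (vertices G w)
  vertices-reverseWalk ε               = refl
  vertices-reverseWalk {u} (e ◅ w) =
    trans (vertices-◅◅ (reverseWalk w) (G.sym e ◅ ε))
    (trans (cong (_++ [ u ]) (vertices-reverseWalk w)) (sym (unfold-reverse u (vertices G w))))

  vertices-reverseWalk-↭ : (w : Walk G u v) → vertices G (reverseWalk w) ↭ vertices G w
  vertices-reverseWalk-↭ w = subst (_↭ vertices G w) (sym (vertices-reverseWalk w)) (↭-reverse _)

  reversePath : Path G u v → Path G v u
  reversePath p = mkPath (reverseWalk (walk p))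
    (Permutation.Unique-resp-↭ (setoid (Fin n)) (↭⇒↭ₛ (↭-sym (vertices-reverseWalk-↭ (walk p)))) (unique p))

  -- Systems of disjoint paths

  -- The endpoint sets of `Linked` are left out, since rerouting changes them. Distinctness of the
  -- endpoints is recovered from disjointness.
  record PathSystem (m : ℕ) : Set where
    field
      start end : Fin m → Fin n
      path      : ∀ i → Path G (start i) (end i)
      disjoint  : ∀ {i j} → i ≢ j → Disjoint (support (path i)) (support (path j))

    On : Fin m → Fin n → Set
    On i x = x ∈ support (path i)

    On? : ∀ i x → Dec (On i x)
    On? i x = Any.any? (x ≟_) (support (path i))

    On-injective : ∀ {i j x} → On i x → On j x → i ≡ j
    On-injective {i} {j} x∈i x∈j with i ≟ j
    ... | yes i≡j = i≡j
    ... | no  i≢j = contradiction (x∈i , x∈j) (disjoint i≢j)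

    start-On : ∀ i → On i (start i)
    start-On i = start∈vertices (walk (path i))

    end-On : ∀ i → On i (end i)
    end-On i = end∈vertices (walk (path i))

    start-injective : Injective _≡_ _≡_ start
    start-injective {i} {j} eq = On-injective (start-On i) (subst (On j) (sym eq) (start-On j))

    end-injective : Injective _≡_ _≡_ end
    end-injective {i} {j} eq = On-injective (end-On i) (subst (On j) (sym eq) (end-On j))

    Precedes : Rel (Fin n) 0ℓ
    Precedes x y = ∃[ i ] Before x y (support (path i))

    Precedes? : B.Decidable Precedes
    Precedes? x y = any? λ i → (x ∷ y ∷ []) ⊆? support (path i)
      where open DecSublist _≟_ using (_⊆?_)

    On-Precedesʳ : ∀ {i x y} → On i x → Precedes x y → Before x y (support (path i))
    On-Precedesʳ x∈i (j , xy) with On-injective x∈i (Before⇒∈ˡ xy)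
    ... | refl = xy

    On-Precedesˡ : ∀ {i x y} → On i y → Precedes x y → Before x y (support (path i))
    On-Precedesˡ y∈i (j , xy) with On-injective y∈i (Before⇒∈ʳ xy)
    ... | refl = xy

    -- The orders along the single paths have a transitive union because, by disjointness, the
    -- middle vertex lies on only one path.
    Precedes-isSPO : IsStrictPartialOrder _≡_ Precedes
    Precedes-isSPO = record
      { isEquivalence = isEquivalence
      ; irrefl        = λ { refl (i , xx) → Before-irrefl (unique (path i)) xx }
      ; trans         = λ { (i , xy) yz →
          i , Before-trans (unique (path i)) xy (On-Precedesʳ (Before⇒∈ʳ xy) yz) }
      ; <-resp-≈      = (λ { refl xy → xy }) , (λ { refl xy → xy })
      }

  open PathSystem

  reversePathSystem : PathSystem m → PathSystem m
  reversePathSystem P = record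
    { start    = end P
    ; end      = start P
    ; path     = reversePath ∘ path P
    ; disjoint = λ {i} {j} i≢j (x∈i , x∈j) →
        disjoint P i≢j (forward i x∈i , forward j x∈j)
    }
    where
    forward : ∀ i {x} → x ∈ support (reversePath (path P i)) → On P i x
    forward i = ∈-resp-↭ (vertices-reverseWalk-↭ (walk (path P i)))

  -- The conclusion of Pym's linkage theorem, trimmed to as many paths as Q has.
  record Linkage (P : PathSystem m) (Q : PathSystem k) : Set where
    field
      system        : PathSystem k
      starts-cover  : ∀ p → ∃[ q ] start system q ≡ start P p
      starts-within : ∀ q → (∃[ p ] start system q ≡ start P p) ⊎ start system q ≡ start Q q
      ends-within   : ∀ q → (∃[ p ] end system q ≡ end P p) ⊎ end system q ≡ end Q q
      ends-fixed    : (∀ p → ∃[ q ] end Q q ≡ end P p) → ∀ q → end system q ≡ end Q q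

  -- Pym's linkage theorem: switching at a common kernel

  module _ (P : PathSystem m) (Q : PathSystem k) (m≤k : m ≤ k) where

    private
      Crossing : Pred (Fin n) 0ℓ
      Crossing x = (∃[ p ] On P p x) × (∃[ q ] On Q q x)

      crossing? : Decidable Crossing
      crossing? x = any? (λ p → On? P p x) ×-dec any? (λ q → On? Q q x)

      -- The order of `Q` is flipped so that a crossing outside the kernel lies after a switch on
      -- its path of `P` or before a switch on its path of `Q`. These are the parts that the new
      -- paths leave out.
      switches : Kernel {_<₁_ = Precedes P} {_<₂_ = flip (Precedes Q)} (comprehension crossing?)
      switches = kernel (Precedes? P) (flip (Precedes? Q)) (Precedes-isSPO P)
                   (Flip.isStrictPartialOrder (Precedes-isSPO Q)) _

      open Kernel switches renaming (set to M)

      ∈M⇒Crossing : x ∈ₛ M → Crossing x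
      ∈M⇒Crossing x∈M = ∈-comprehension⁻ crossing? (set⊆ x∈M)

      -- The vertices of one path are linearly ordered, so an independent set has at most one of
      -- them. The same reason gives `unique-on-Q`.
      unique-on-P : ∀ {p} → x ∈ₛ M → y ∈ₛ M → On P p x → On P p y → x ≡ y
      unique-on-P x∈M y∈M x∈p y∈p with Before-total x∈p y∈p
      ... | inj₁ x≡y       = x≡y
      ... | inj₂ (inj₁ xy) = contradiction (_ , xy) (independent₁ x∈M y∈M)
      ... | inj₂ (inj₂ yx) = contradiction (_ , yx) (independent₁ y∈M x∈M)

      unique-on-Q : ∀ {q} → x ∈ₛ M → y ∈ₛ M → On Q q x → On Q q y → x ≡ y
      unique-on-Q x∈M y∈M x∈q y∈q with Before-total x∈q y∈q
      ... | inj₁ x≡y       = x≡y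
      ... | inj₂ (inj₁ xy) = contradiction (_ , xy) (independent₂ y∈M x∈M)
      ... | inj₂ (inj₂ yx) = contradiction (_ , yx) (independent₂ x∈M y∈M)

      _~_ : REL (Fin m) (Fin k) 0ℓ
      p ~ q = ∃[ x ] x ∈ₛ M × On P p x × On Q q x

      _~?_ : B.Decidable _~_
      p ~? q = any? λ x → (x ∈? M) ×-dec On? P p x ×-dec On? Q q x

      ~-functional : ∀ {p q q′} → p ~ q → p ~ q′ → q ≡ q′
      ~-functional (x , x∈M , x∈p , x∈q) (y , y∈M , y∈p , y∈q′) with unique-on-P x∈M y∈M x∈p y∈p
      ... | refl = On-injective Q x∈q y∈q′

      ~-injective : ∀ {p p′ q} → p ~ q → p′ ~ q → p ≡ p′
      ~-injective (x , x∈M , x∈p , x∈q) (y , y∈M , y∈p′ , y∈q) with unique-on-Q x∈M y∈M x∈q y∈q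
      ... | refl = On-injective P x∈p y∈p′

      -- New paths are numbered like those of `Q`, and `f p` is the number of the one that starts
      -- along `p`. A switched `p` gets the number of the path it changes to; an unswitched `p`
      -- displaces a path of `Q` to which nothing changes.
      matching : ∃[ f ] Injective _≡_ _≡_ f × (∀ {p q} → p ~ q → f p ≡ q)
      matching = extendMatching _~?_ m≤k ~-functional ~-injective

      f : Fin m → Fin k
      f = proj₁ matching

      f-injective : Injective _≡_ _≡_ f
      f-injective = proj₁ (proj₂ matching)

      f-extends : ∀ {p q} → p ~ q → f p ≡ q
      f-extends = proj₂ (proj₂ matching)

      Unswitched : Fin m → Set
      Unswitched p = ¬ (∃[ x ] x ∈ₛ M × On P p x)

      -- What may lie on the q-th new path: vertices of P not beyond a switch, and vertices of Q not
      -- before one. By absorption a vertex live in both senses is itself a switch.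
      LiveP : Fin k → Pred (Fin n) 0ℓ
      LiveP q x = ∃[ p ] f p ≡ q × On P p x × (∀ {y} → y ∈ₛ M → ¬ Precedes P y x)

      LiveQ : Fin k → Pred (Fin n) 0ℓ
      LiveQ q x = On Q q x × (∀ {y} → y ∈ₛ M → ¬ Precedes Q x y)

      LiveP∧LiveQ⇒∈M : ∀ {q q′} → LiveP q x → LiveQ q′ x → x ∈ₛ M
      LiveP∧LiveQ⇒∈M (_ , _ , x∈p , ¬P) (x∈q , ¬Q)
        with absorbing (∈-comprehension⁺ crossing? ((_ , x∈p) , (_ , x∈q)))
      ... | inj₁ x∈M                   = x∈M
      ... | inj₂ (_ , y∈M , inj₁ y<x)  = contradiction y<x (¬P y∈M)
      ... | inj₂ (_ , y∈M , inj₂ y<x)  = contradiction y<x (¬Q y∈M)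

      -- The common vertex is a switch from some `p` to `q′`, and `f` respects switches.
      LiveP∧LiveQ⇒≡ : ∀ {q q′} → LiveP q x → LiveQ q′ x → q ≡ q′
      LiveP∧LiveQ⇒≡ lp@(_ , refl , x∈p , _) lq@(x∈q , _) = f-extends (_ , LiveP∧LiveQ⇒∈M lp lq , x∈p , x∈q)

      -- The invariant `live` yields disjointness of the routes without comparing their
      -- constructions. The extra data in the two cases serve `starts-cover` and `ends-fixed`.
      record Route (q : Fin k) : Set where
        field
          {source sink} : Fin n
          route       : Path G source sink
          live        : ∀ {x} → x ∈ support route → LiveP q x ⊎ LiveQ q x
          source-case : (∃[ p ] f p ≡ q × source ≡ start P p) ⊎
                        (∀ p → f p ≢ q) × source ≡ start Q q
          sink-case   : (∃[ p ] Unswitched p × sink ≡ end P p) ⊎ sink ≡ end Q q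

      -- A switch on this path would come from some `p` with `f p ≡ q`. So there is none, and the
      -- whole path is live.
      onlyQ : ∀ {q} → (∀ p → f p ≢ q) → Route q
      onlyQ {q} free = record
        { route       = path Q q
        ; live        = λ x∈q → inj₂ (x∈q , λ y∈M x<y → not-switched y∈M (Before⇒∈ʳ (On-Precedesʳ Q x∈q x<y)))
        ; source-case = inj₂ (free , refl)
        ; sink-case   = inj₂ refl
        }
        where
        not-switched : y ∈ₛ M → ¬ On Q q y
        not-switched y∈M y∈q =
          let ((p , y∈p) , _) = ∈M⇒Crossing y∈M in free p (f-extends (_ , y∈M , y∈p , y∈q))

      onlyP : ∀ {p} → Unswitched p → Route (f p)
      onlyP {p} unswitched = record
        { route       = path P p
        ; live        = λ x∈p → inj₁ (p , refl , x∈p , λ y∈M y<x → unswitched (_ , y∈M , Before⇒∈ˡ (On-Precedesˡ P x∈p y<x)))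
        ; source-case = inj₁ (p , refl , refl)
        ; sink-case   = inj₁ (p , unswitched , refl)
        }

      -- Follow `p` as far as `x`, then `q`. Both pieces are live because `x` is the only switch on
      -- `p` and on `q`.
      switch : ∀ {p q} → x ∈ₛ M → On P p x → On Q q x → Route q
      switch {x} {p} {q} x∈M x∈p x∈q
        with split (walk (path P p)) x∈p | split (walk (path Q q)) x∈q
      ... | w₁ , w₁′ , eqP | w₂′ , w₂ , eqQ = record
        { route       = mkPath (w₁ ◅◅ w₂) (subst Unique (sym (vertices-◅◅ w₁ w₂)) route-unique)
        ; live        = λ y∈ → live (∈-++⁻ (vertices G w₁) (subst (_ ∈_) (vertices-◅◅ w₁ w₂) y∈))
        ; source-case = inj₁ (p , fp≡q , refl)
        ; sink-case   = inj₂ refl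
        }
        where
        fp≡q : f p ≡ q
        fp≡q = f-extends (x , x∈M , x∈p , x∈q)

        uP : Unique (support (path P p))
        uP = unique (path P p)

        uQ : Unique (support (path Q q))
        uQ = unique (path Q q)

        head⊆ : vertices G w₁ Sublist.⊆ support (path P p)
        head⊆ = subst (vertices G w₁ Sublist.⊆_) (sym eqP) (Sublistₚ.++⁺ʳ _ Sublist.⊆-refl)

        tail⊆ : tailVertices w₂ Sublist.⊆ support (path Q q)
        tail⊆ = subst (tailVertices w₂ Sublist.⊆_) (sym eqQ) (Sublistₚ.++⁺ˡ (vertices G w₂′) Sublist.⊆-refl)

        head-≤ : y ∈ vertices G w₁ → y ≡ x ⊎ Before y x (support (path P p))
        head-≤ y∈ with ≡end⊎Before-end w₁ y∈
        ... | inj₁ y≡x = inj₁ y≡x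
        ... | inj₂ yx  = inj₂ (Sublist.⊆-trans yx head⊆)

        tail-> : y ∈ tailVertices w₂ → Before x y (support (path Q q))
        tail-> y∈ = subst (Before x _) (sym eqQ) (++-Before (end∈vertices w₂′) y∈)

        head-live : y ∈ vertices G w₁ → LiveP q y
        head-live {y} y∈ = p , fp≡q , y∈p , not-after
          where
          y∈p : On P p y
          y∈p = Sublist.lookup head⊆ y∈
          not-after : ∀ {z} → z ∈ₛ M → ¬ Precedes P z y
          not-after z∈M z<y with On-Precedesˡ P y∈p z<y
          ... | zy with unique-on-P z∈M x∈M (Before⇒∈ˡ zy) x∈p
          ...   | refl with head-≤ y∈
          ...     | inj₁ refl = Before-irrefl uP zy
          ...     | inj₂ yx   = Before-asym uP yx zy

        tail-live : y ∈ tailVertices w₂ → LiveQ q y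
        tail-live {y} y∈ = y∈q , not-before
          where
          y∈q : On Q q y
          y∈q = Sublist.lookup tail⊆ y∈
          not-before : ∀ {z} → z ∈ₛ M → ¬ Precedes Q y z
          not-before z∈M y<z with On-Precedesʳ Q y∈q y<z
          ... | yz with unique-on-Q z∈M x∈M (Before⇒∈ʳ yz) x∈q
          ...   | refl = Before-asym uQ yz (tail-> y∈)

        live : y ∈ vertices G w₁ ⊎ y ∈ tailVertices w₂ → LiveP q y ⊎ LiveQ q y
        live (inj₁ y∈) = inj₁ (head-live y∈)
        live (inj₂ y∈) = inj₂ (tail-live y∈)

        route-unique : Unique (vertices G w₁ ++ tailVertices w₂)
        route-unique = Unique.++⁺ (Unique-resp-⊇ head⊆ uP) (Unique-resp-⊇ tail⊆ uQ) head-tail-disjoint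
          where
          -- A common vertex is live in both senses, hence a switch on `p`, hence `x` itself; but
          -- the tail lies strictly after `x` on `q`.
          head-tail-disjoint : Disjoint (vertices G w₁) (tailVertices w₂)
          head-tail-disjoint (y∈₁ , y∈₂)
            with unique-on-P (LiveP∧LiveQ⇒∈M (head-live y∈₁) (tail-live y∈₂)) x∈M (Sublist.lookup head⊆ y∈₁) x∈p
          ... | refl = Before-irrefl uQ (tail-> y∈₂)

      routes : ∀ q → Route q
      routes q with any? (λ p → f p ≟ q)
      ... | no free = onlyQ λ p fp≡q → free (p , fp≡q)
      ... | yes (p , refl) with any? (λ x → (x ∈? M) ×-dec On? P p x)
      ...   | no unswitched = onlyP unswitched
      ...   | yes (x , x∈M , x∈p) with ∈M⇒Crossing x∈M
      -- The path `q′` of `Q` through the switch is number `f p`, as `f` extends `_~_`.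
      ...     | _ , (q′ , x∈q′) = switch x∈M x∈p (subst (λ q → On Q q x) (sym (f-extends (x , x∈M , x∈p , x∈q′))) x∈q′)

      module R q = Route (routes q)

      -- Two claims of the same kind are settled by disjointness within `P` or within `Q`, mixed
      -- ones by the vertex being a switch.
      Live-injective : ∀ {q q′} → LiveP q x ⊎ LiveQ q x → LiveP q′ x ⊎ LiveQ q′ x → q ≡ q′
      Live-injective (inj₁ (p , refl , x∈p , _)) (inj₁ (p′ , refl , x∈p′ , _)) = cong f (On-injective P x∈p x∈p′)
      Live-injective (inj₁ lp)                   (inj₂ lq)                     = LiveP∧LiveQ⇒≡ lp lq
      Live-injective (inj₂ lq)                   (inj₁ lp)                     = sym (LiveP∧LiveQ⇒≡ lp lq)
      Live-injective (inj₂ (x∈q , _))            (inj₂ (x∈q′ , _))             = On-injective Q x∈q x∈q′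

      -- As `f` is injective, the path of `P` along which route `f p` starts can only be `p`.
      starts-cover : ∀ p → R.source (f p) ≡ start P p
      starts-cover p with R.source-case (f p)
      ... | inj₁ (p′ , eq , src) with f-injective eq
      ...   | refl = src
      starts-cover p | inj₂ (free , _) = contradiction refl (free p)

      starts-within : ∀ q → (∃[ p ] R.source q ≡ start P p) ⊎ R.source q ≡ start Q q
      starts-within q with R.source-case q
      ... | inj₁ (p , _ , eq) = inj₁ (p , eq)
      ... | inj₂ (_ , eq)     = inj₂ eq

      ends-within : ∀ q → (∃[ p ] R.sink q ≡ end P p) ⊎ R.sink q ≡ end Q q
      ends-within q with R.sink-case q
      ... | inj₁ (p , _ , eq) = inj₁ (p , eq)
      ... | inj₂ eq           = inj₂ eq

      -- A path of P that ends on the last vertex of a path of Q crosses it there, and nothing on Q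
      -- could absorb that crossing.
      ends-on-Q⇒switched : ∀ {p q} → end Q q ≡ end P p → ¬ Unswitched p
      ends-on-Q⇒switched {p} {q} eq unswitched
        with absorbing (∈-comprehension⁺ crossing? ((p , end-On P p) , (q , subst (On Q q) eq (end-On Q q))))
      ... | inj₁ e∈M = unswitched (_ , e∈M , end-On P p)
      ... | inj₂ (y , y∈M , inj₁ y<e) =
        unswitched (y , y∈M , Before⇒∈ˡ (On-Precedesˡ P (end-On P p) y<e))
      ... | inj₂ (y , y∈M , inj₂ e<y) with On-Precedesʳ Q (subst (On Q q) eq (end-On Q q)) e<y
      ...   | ey with ≡end⊎Before-end (walk (path Q q)) (Before⇒∈ʳ ey)
      ...     | inj₁ refl = Before-irrefl (unique (path Q q)) (subst (λ e → Before e _ _) (sym eq) ey)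
      ...     | inj₂ ye   = Before-asym (unique (path Q q)) ye (subst (λ e → Before e _ _) (sym eq) ey)

      ends-fixed : (∀ p → ∃[ q ] end Q q ≡ end P p) → ∀ q → R.sink q ≡ end Q q
      ends-fixed ends⊆ q with R.sink-case q
      ... | inj₁ (p , unswitched , _) = contradiction unswitched (ends-on-Q⇒switched (proj₂ (ends⊆ p)))
      ... | inj₂ eq                   = eq

    abstract
      linkage : Linkage P Q
      linkage = record
        { system        = record
            { start    = λ q → R.source q
            ; end      = λ q → R.sink q
            ; path     = R.route
            ; disjoint = λ {q} {q′} q≢q′ (x∈q , x∈q′) → q≢q′ (Live-injective (R.live q x∈q) (R.live q′ x∈q′))
            }
        ; starts-cover  = λ p → f p , starts-cover p
        ; starts-within = starts-within
        ; ends-within   = ends-within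
        ; ends-fixed    = ends-fixed
        }

-- Sizes of unions, differences and images

∣p∪q∣≡∣p∣+∣q∣ : (p q : Subset n) → Empty (p ∩ q) → ∣ p ∪ q ∣ ≡ ∣ p ∣ + ∣ q ∣
∣p∪q∣≡∣p∣+∣q∣ []            []            _ = refl
∣p∪q∣≡∣p∣+∣q∣ (inside  ∷ p) (inside  ∷ q) e = contradiction (zero , here) e
∣p∪q∣≡∣p∣+∣q∣ (inside  ∷ p) (outside ∷ q) e = cong suc (∣p∪q∣≡∣p∣+∣q∣ p q (Subset.drop-∷-Empty e))
∣p∪q∣≡∣p∣+∣q∣ (outside ∷ p) (inside  ∷ q) e =
  trans (cong suc (∣p∪q∣≡∣p∣+∣q∣ p q (Subset.drop-∷-Empty e))) (sym (+-suc ∣ p ∣ ∣ q ∣))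
∣p∪q∣≡∣p∣+∣q∣ (outside ∷ p) (outside ∷ q) e = ∣p∪q∣≡∣p∣+∣q∣ p q (Subset.drop-∷-Empty e)

x∈p─q⇒x∉q : (p q : Subset n) {x : Fin n} → x ∈ₛ p ─ q → x ∉ₛ q
x∈p─q⇒x∉q (_ ∷ p) (inside  ∷ q) (there x∈) (there x∈q) = x∈p─q⇒x∉q p q x∈ x∈q
x∈p─q⇒x∉q (_ ∷ p) (outside ∷ q) (there x∈) (there x∈q) = x∈p─q⇒x∉q p q x∈ x∈q

p∩[q─p]-Empty : (p q : Subset n) → Empty (p ∩ (q ─ p))
p∩[q─p]-Empty p q (x , x∈) with x∈p∩q⁻ p (q ─ p) x∈
... | x∈p , x∈q─p = x∈p─q⇒x∉q q p x∈q─p x∈p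

p∪[q─p]≡q : (p q : Subset n) → p ⊆ q → p ∪ (q ─ p) ≡ q
p∪[q─p]≡q p q p⊆q = ⊆-antisym ⊆q q⊆
  where
  ⊆q : p ∪ (q ─ p) ⊆ q
  ⊆q x∈ with x∈p∪q⁻ p (q ─ p) x∈
  ... | inj₁ x∈p   = p⊆q x∈p
  ... | inj₂ x∈q─p = p─q⊆p q p x∈q─p
  q⊆ : q ⊆ p ∪ (q ─ p)
  q⊆ {x} x∈q with x ∈? p
  ... | yes x∈p = x∈p∪q⁺ (inj₁ x∈p)
  ... | no  x∉p = x∈p∪q⁺ (inj₂ (x∈p∧x∉q⇒x∈p─q x∈q x∉p))

-- Defined by recursion on the domain so that its size can be computed by induction.
image : (Fin m → Fin n) → Subset n
image {zero}  f = ⊥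
image {suc m} f = ⁅ f zero ⁆ ∪ image (f ∘ suc)

∈-image⁺ : (f : Fin m → Fin n) → ∀ i → f i ∈ₛ image f
∈-image⁺ f zero    = x∈p∪q⁺ (inj₁ (x∈⁅x⁆ (f zero)))
∈-image⁺ f (suc i) = x∈p∪q⁺ (inj₂ (∈-image⁺ (f ∘ suc) i))

∈-image⁻ : (f : Fin m → Fin n) {x : Fin n} → x ∈ₛ image f → ∃[ i ] f i ≡ x
∈-image⁻ {zero}  f x∈ = contradiction x∈ ∉⊥
∈-image⁻ {suc m} f x∈ with x∈p∪q⁻ ⁅ f zero ⁆ (image (f ∘ suc)) x∈
... | inj₁ x∈f0 = zero , sym (x∈⁅y⁆⇒x≡y (f zero) x∈f0)
... | inj₂ x∈fs with ∈-image⁻ (f ∘ suc) x∈fs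
...   | i , eq = suc i , eq

∣image∣≡ : (f : Fin m → Fin n) → Injective _≡_ _≡_ f → ∣ image f ∣ ≡ m
∣image∣≡ {zero}  {n} f inj = ∣⊥∣≡0 n
∣image∣≡ {suc m}     f inj = trans (∣p∪q∣≡∣p∣+∣q∣ ⁅ f zero ⁆ (image (f ∘ suc)) f0∉)
  (cong₂ _+_ (∣⁅x⁆∣≡1 (f zero)) (∣image∣≡ (f ∘ suc) (suc-injective ∘ inj)))
  where
  f0∉ : Empty (⁅ f zero ⁆ ∩ image (f ∘ suc))
  f0∉ (x , x∈) with x∈p∩q⁻ ⁅ f zero ⁆ (image (f ∘ suc)) x∈
  ... | x∈f0 , x∈fs with ∈-image⁻ (f ∘ suc) x∈fs
  ...   | i , eq = Fin.0≢1+n (inj (trans (sym (x∈⁅y⁆⇒x≡y (f zero) x∈f0)) (sym eq)))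

-- If the image missed an element of `p` it would be a proper subset, hence smaller, yet both have
-- size `m`.
injective⇒covers : (f : Fin m → Fin n) → Injective _≡_ _≡_ f → (p : Subset n) → ∣ p ∣ ≡ m →
                   (∀ i → f i ∈ₛ p) → p ⊆ image f
injective⇒covers f inj p ∣p∣≡m f∈p {x} x∈p with x ∈? image f
... | yes x∈ = x∈
... | no  x∉ = contradiction (p⊂q⇒∣p∣<∣q∣ (image⊆p , x , x∈p , x∉)) (<-irrefl (trans (∣image∣≡ f inj) (sym ∣p∣≡m)))
  where
  image⊆p : image f ⊆ p
  image⊆p y∈ with ∈-image⁻ f y∈
  ... | i , refl = f∈p i

-- Passing between linkages and path systems

module _ (G : Graph n) where

  open PathSystem

  Linked⇒PathSystem : ∀ {A B} → Linked G m A B → PathSystem G m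
  Linked⇒PathSystem L = record { start = L.start ; end = L.end ; path = L.path ; disjoint = L.disjoint }
    where module L = Linked L

  -- When the two sets are exactly the starts and the ends, `MeetsOnce` comes from disjointness: the
  -- only start on a path is its own, and likewise for ends.
  PathSystem⇒Linked : (P : PathSystem G m) → Linked G m (image (start P)) (image (end P))
  PathSystem⇒Linked P = record
    { start           = start P
    ; end             = end P
    ; start-injective = start-injective P
    ; end-injective   = end-injective P
    ; start∈A₁        = ∈-image⁺ (start P)
    ; end∈A₂          = ∈-image⁺ (end P)
    ; path            = path P
    ; disjoint        = disjoint P
    ; meets-A₁        = λ i → start P i , (start-On P i , ∈-image⁺ (start P) i) , λ { (x∈i , x∈) → start-only i x∈i x∈ }
    ; meets-A₂        = λ i → end P i , (end-On P i , ∈-image⁺ (end P) i) , λ { (x∈i , x∈) → end-only i x∈i x∈ }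
    }
    where
    start-only : ∀ i {x} → On P i x → x ∈ₛ image (start P) → start P i ≡ x
    start-only i x∈i x∈ with ∈-image⁻ (start P) x∈
    ... | j , refl = cong (start P) (On-injective P x∈i (start-On P j))
    end-only : ∀ i {x} → On P i x → x ∈ₛ image (end P) → end P i ≡ x
    end-only i x∈i x∈ with ∈-image⁻ (end P) x∈
    ... | j , refl = cong (end P) (On-injective P x∈i (end-On P j))

  start-covers : ∀ {A B} (L : Linked G m A B) → ∣ A ∣ ≡ m → ∀ {x} → x ∈ₛ A → ∃[ i ] Linked.start L i ≡ x
  start-covers {A = A} L ∣A∣≡m x∈A =
    ∈-image⁻ L.start (injective⇒covers L.start L.start-injective A ∣A∣≡m L.start∈A₁ x∈A)
    where module L = Linked L

  end-covers : ∀ {A B} (L : Linked G m A B) → ∣ B ∣ ≡ m → ∀ {x} → x ∈ₛ B → ∃[ i ] Linked.end L i ≡ x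
  end-covers {B = B} L ∣B∣≡m x∈B =
    ∈-image⁻ L.end (injective⇒covers L.end L.end-injective B ∣B∣≡m L.end∈A₂ x∈B)
    where module L = Linked L

-- Enlarging the linked subsets

completion : (f : Fin k → Fin n) → Injective _≡_ _≡_ f → (S T : Subset n) → (∀ i → f i ∈ₛ S) →
             ∀ {t} → t ≤ k → ∣ T ∣ ≡ k ∸ t → T ⊆ image f →
             ∃[ T′ ] T′ ⊆ S ─ T × ∣ T′ ∣ ≡ t × image f ≡ T ∪ T′
-- All of `T` is already in the image, so the enlargement is the rest of the image, of size k - (k -
-- t) = t.
completion {k} f inj S T f∈S {t} t≤k ∣T∣≡ T⊆ = X ─ T , ⊆S─T , size , sym (p∪[q─p]≡q T X T⊆)
  where
  X : Subset _
  X = image f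
  ⊆S─T : X ─ T ⊆ S ─ T
  ⊆S─T x∈ with ∈-image⁻ f (p─q⊆p X T x∈)
  ... | i , refl = x∈p∧x∉q⇒x∈p─q (f∈S i) (x∈p─q⇒x∉q X T x∈)
  open ≡-Reasoning
  size : ∣ X ─ T ∣ ≡ t
  size = +-cancelˡ-≡ (k ∸ t) _ _ (begin
    (k ∸ t) + ∣ X ─ T ∣  ≡⟨ cong (_+ ∣ X ─ T ∣) ∣T∣≡ ⟨
    ∣ T ∣ + ∣ X ─ T ∣    ≡⟨ ∣p∪q∣≡∣p∣+∣q∣ T (X ─ T) (p∩[q─p]-Empty T X) ⟨
    ∣ T ∪ (X ─ T) ∣      ≡⟨ cong ∣_∣ (p∪[q─p]≡q T X T⊆) ⟩
    ∣ X ∣                ≡⟨ ∣image∣≡ f inj ⟩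
    k                    ≡⟨ m∸n+n≡m t≤k ⟨
    (k ∸ t) + t          ∎)

theorem2p3 : ∀ {n : ℕ} (G : Graph n) (k t : ℕ) → 1 ≤ t → t ≤ k →
    (S₁ S₂ : Subset n) → Empty (S₁ ∩ S₂) → Linked G k S₁ S₂ →
    (T₁ T₂ : Subset n) → T₁ ⊆ S₁ → T₂ ⊆ S₂ →
    ∣ T₁ ∣ ≡ k ∸ t → ∣ T₂ ∣ ≡ k ∸ t → Linked G (k ∸ t) T₁ T₂ →
    ∃₂ λ (T₁′ T₂′ : Subset n) →
    T₁′ ⊆ S₁ ─ T₁ × ∣ T₁′ ∣ ≡ t ×
    T₂′ ⊆ S₂ ─ T₂ × ∣ T₂′ ∣ ≡ t ×
    Linked G k (T₁ ∪ T₁′) (T₂ ∪ T₂′)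
theorem2p3 {n} G k t _ t≤k S₁ S₂ _ LS T₁ T₂ T₁⊆S₁ T₂⊆S₂ ∣T₁∣ ∣T₂∣ LT =
  let T₁′ , T₁′⊆ , ∣T₁′∣ , eq₁ = completion (start R) (start-injective R) S₁ T₁ start∈S₁ t≤k ∣T₁∣ T₁⊆starts
      T₂′ , T₂′⊆ , ∣T₂′∣ , eq₂ = completion (end R) (end-injective R) S₂ T₂ end∈S₂ t≤k ∣T₂∣ T₂⊆ends
  in T₁′ , T₂′ , T₁′⊆ , ∣T₁′∣ , T₂′⊆ , ∣T₂′∣ , subst₂ (Linked G k) eq₁ eq₂ (PathSystem⇒Linked G R)
  where
  open PathSystem
  module LS = Linked LS
  module LT = Linked LT

  PS : PathSystem G k
  PS = Linked⇒PathSystem G LS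

  PT : PathSystem G (k ∸ t)
  PT = Linked⇒PathSystem G LT

  -- The first pass brings `T₁` among the starts; the second, run backwards, brings `T₂` among the
  -- ends.
  module L₁ = Linkage (linkage G PT PS (m∸n≤m k t))
  module L₂ = Linkage (linkage G (reversePathSystem G PT) (reversePathSystem G L₁.system) (m∸n≤m k t))

  R : PathSystem G k
  R = reversePathSystem G L₂.system

  -- Reversed, every path of `PT` ends at a start of `L₁.system`, which is the hypothesis of
  -- `ends-fixed`. So the second pass cannot lose `T₁`.
  start-fixed : ∀ q → start R q ≡ start L₁.system q
  start-fixed = L₂.ends-fixed L₁.starts-cover

  start∈S₁ : ∀ q → start R q ∈ₛ S₁
  start∈S₁ q with L₁.starts-within q
  ... | inj₁ (p , eq) = subst (_∈ₛ S₁) (sym (trans (start-fixed q) eq)) (T₁⊆S₁ (LT.start∈A₁ p))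
  ... | inj₂ eq       = subst (_∈ₛ S₁) (sym (trans (start-fixed q) eq)) (LS.start∈A₁ q)

  -- Each pass either keeps the end or replaces it by an end from `PT`, so it traces back to `PT` or
  -- to `PS`.
  end∈S₂ : ∀ q → end R q ∈ₛ S₂
  end∈S₂ q with L₂.starts-within q
  ... | inj₁ (p , eq) = subst (_∈ₛ S₂) (sym eq) (T₂⊆S₂ (LT.end∈A₂ p))
  ... | inj₂ eq with L₁.ends-within q
  ...   | inj₁ (p , eq′) = subst (_∈ₛ S₂) (sym (trans eq eq′)) (T₂⊆S₂ (LT.end∈A₂ p))
  ...   | inj₂ eq′       = subst (_∈ₛ S₂) (sym (trans eq eq′)) (LS.end∈A₂ q)

  T₁⊆starts : T₁ ⊆ image (start R)
  T₁⊆starts x∈ with start-covers G LT ∣T₁∣ x∈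
  ... | p , refl with L₁.starts-cover p
  ...   | q , eq = subst (_∈ₛ image (start R)) (trans (start-fixed q) eq) (∈-image⁺ (start R) q)

  T₂⊆ends : T₂ ⊆ image (end R)
  T₂⊆ends x∈ with end-covers G LT ∣T₂∣ x∈
  ... | p , refl with L₂.starts-cover p
  ...   | q , eq = subst (_∈ₛ image (end R)) eq (∈-image⁺ (end R) q)
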